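{- Let $n\ge 0$ be an integer and let $\lambda\in\mathbb{C}$ be nonzero. Then $$\beta_{n,\lambda}^{(2)}=\sum_{l=0}^{n}\binom{n}{l}\beta_{l,\lambda}(1)\,\frac{b_{n-l,\lambda}(-\lambda)}{n-l+1}.$$
   Context: All generating function identities are identities of formal power series in $t$, with $\lambda$ nonzero, $(1+\lambda t)^{a}=\sum_{j\ge0}(a)_j\lambda^j\frac{t^j}{j!}$ and $(a)_j=a(a-1)\cdots(a-j+1)$, $(a)_0=1$. For $k\in\mathbb{Z}$, $\mathrm{Li}_k(u)=\sum_{n=1}^{\infty}\frac{u^n}{n^k}$. The fully degenerate poly-Bernoulli numbers $\beta_{n,\lambda}^{(k)}$ are defined by $$\frac{\mathrm{Li}_{k}\left(1-(1+\lambda t)^{ -1/\lambda}\right)}{1-(1+\lambda t)^{ -1/\lambda}}=\sum_{n=0}^{\infty}\beta_{n,\lambda}^{(k)}\frac{t^{n}}{n!},$$ where $\mathrm{Li}_k(u)/u$ denotes the series $\sum_{m\ge 0}u^m/(m+1)^k$; here $k=2$. Carlitz's degenerate Bernoulli polynomials $\beta_{n,\lambda}(x)$ (no superscript) are defined by $$\frac{t}{(1+\lambda t)^{1/\lambda}-1}(1+\lambda t)^{x/\lambda}=\sum_{n=0}^{\infty}\beta_{n,\lambda}(x)\frac{t^n}{n!}.$$ The polynomials $b_{n,\lambda}(x)$ are defined by $$\frac{\frac{1}{\lambda}\log(1+\lambda t)}{(1+\lambda t)^{1/\lambda}-1}(1+\lambda t)^{x/\lambda}=\sum_{n=0}^{\infty}b_{n,\lambda}(x)\frac{t^n}{n!},$$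 and $b_{m,\lambda}(-\lambda)$ is the value at $x=-\lambda$. -}

module Defs where

open import Algebra.Apartness.Bundles using (HeytingField; HeytingCommutativeRing)
open import Algebra.Bundles using (CommutativeRing; Semiring)
import Algebra.Definitions as Definitions
import Algebra.Definitions.RawMonoid as RawMonoidDefs
import Algebra.Definitions.RawSemiring as RawSemiringDefs
import Algebra.Properties.Ring as RingProperties
import Algebra.Properties.Semiring.Sum as SemiringSum
open import Data.Fin.Base using (toℕ)
open import Data.Integer.Base using (ℤ; +_; -[1+_])
open import Data.Nat.Base using (ℕ; zero; suc; _∸_; _!; NonZero)
open import Data.Nat.Properties using (_!≢0)
open import Data.Product.Base using (_,_; proj₁; proj₂)
open import Function.Base using (_∘_)
import Relation.Binary.Reasoning.Setoid as SetoidReasoning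

CharacteristicZero : ∀ {c ℓ₁ ℓ₂} → HeytingField c ℓ₁ ℓ₂ → Set ℓ₂
CharacteristicZero K = ∀ n → .{{NonZero n}} → (n × 1#) # 0#
  where
  open HeytingField K
  open RawMonoidDefs
    (CommutativeRing.+-rawMonoid (HeytingCommutativeRing.commutativeRing heytingCommutativeRing))
    using (_×_)

module PowerSeries {c ℓ₁ ℓ₂} (K : HeytingField c ℓ₁ ℓ₂) (char0 : CharacteristicZero K) where

  open HeytingField K using (_#_; #⇒invertible; heytingCommutativeRing)
  open CommutativeRing (HeytingCommutativeRing.commutativeRing heytingCommutativeRing) public
  open RawSemiringDefs (Semiring.rawSemiring semiring) public using (_×_; _^_)
  open SemiringSum semiring public using (sum; sum-syntax; sum⁺-syntax)
  open Definitions _≈_ public using (Invertible)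
  open RingProperties ring using (-0#≈0#)
  open SetoidReasoning setoid

  #0⇒invertible : ∀ {x} → x # 0# → Invertible 1# _*_ x
  #0⇒invertible {x} x#0 with #⇒invertible x#0
  ... | y , yx≈1 , xy≈1 = y , trans (*-congˡ x≈x-0) yx≈1 , trans (*-congʳ x≈x-0) xy≈1
    where
    x≈x-0 : x ≈ x - 0#
    x≈x-0 = sym (trans (+-congˡ -0#≈0#) (+-identityʳ x))

  infix 9 1/_

  1/_ : ∀ n → .{{NonZero n}} → Carrier
  1/ n = proj₁ (#0⇒invertible (char0 n))

  fallingFactorial : Carrier → ℕ → Carrier
  fallingFactorial a zero    = 1#
  fallingFactorial a (suc j) = fallingFactorial a j * (a - j × 1#)

  1/_^ℤ_ : ∀ n → .{{NonZero n}} → ℤ → Carrier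
  1/ n ^ℤ (+ k)    = (1/ n) ^ k
  1/ n ^ℤ -[1+ k ] = (n × 1#) ^ suc k

  -- F n is the coefficient of tⁿ (not of tⁿ/n!).
  Series : Set c
  Series = ℕ → Carrier

  infix  4 _≋_
  infixl 6 _-ˢ_
  infixl 7 _*ˢ_ _•_
  infixr 8 _^ˢ_

  _≋_ : Series → Series → Set ℓ₁
  F ≋ G = ∀ n → F n ≈ G n

  _-ˢ_ : Series → Series → Series
  (F -ˢ G) n = F n - G n

  _•_ : Carrier → Series → Series
  (a • F) n = a * F n

  _*ˢ_ : Series → Series → Series
  (F *ˢ G) n = ∑[ i ≤ n ] (F (toℕ i) * G (n ∸ toℕ i))

  1ˢ : Series
  1ˢ zero    = 1#
  1ˢ (suc _) = 0#

  t : Series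
  t zero    = 0#
  t (suc n) = 1ˢ n

  _^ˢ_ : Series → ℕ → Series
  F ^ˢ zero  = 1ˢ
  F ^ˢ suc m = F *ˢ F ^ˢ m

  -- Meaningful only when U 0 ≈ 0#: then Uᵐ has no terms below tᵐ, so
  -- cutting the sum off at m = n loses nothing.
  _∘ˢ_ : Series → Series → Series
  (F ∘ˢ U) n = ∑[ m ≤ n ] (F (toℕ m) * (U ^ˢ toℕ m) n)

  -- Long division, for an invertible constant term of the divisor.
  divide : (F G : Series) → Invertible 1# _*_ (G 0) → Series
  divide F G (u , _) zero    = F 0 * u
  divide F G (u , p) (suc n) = divide (λ i → F (suc i) - F 0 * u * G (suc i)) G (u , p) n

  divide-*ˢ : ∀ F G inv → divide F G inv *ˢ G ≋ F
  divide-*ˢ F G (u , ug≈1 , _) zero = begin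
    F 0 * u * G 0 + 0#  ≈⟨ +-identityʳ _ ⟩
    F 0 * u * G 0       ≈⟨ *-assoc _ _ _ ⟩
    F 0 * (u * G 0)     ≈⟨ *-congˡ ug≈1 ⟩
    F 0 * 1#            ≈⟨ *-identityʳ _ ⟩
    F 0                 ∎
  divide-*ˢ F G inv@(u , _) (suc n) = begin
    q + (divide (λ i → F (suc i) - F 0 * u * G (suc i)) G inv *ˢ G) n
                              ≈⟨ +-congˡ (divide-*ˢ (λ i → F (suc i) - F 0 * u * G (suc i)) G inv n) ⟩
    q + (F (suc n) - q)       ≈⟨ +-comm _ _ ⟩
    (F (suc n) - q) + q       ≈⟨ +-assoc _ _ _ ⟩
    F (suc n) + (- q + q)     ≈⟨ +-congˡ (-‿inverseˡ q) ⟩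
    F (suc n) + 0#            ≈⟨ +-identityʳ _ ⟩
    F (suc n)                 ∎
    where
    q : Carrier
    q = F 0 * u * G (suc n)

  -- F / G when both constant terms vanish and the coefficient of t in G is
  -- invertible: cancel the common factor t, then divide.
  quotient : (F G : Series) → Invertible 1# _*_ (G 1) → Series
  quotient F G = divide (F ∘ suc) (G ∘ suc)

  *ˢ-suc : ∀ F G n →
    (F *ˢ G) (suc n) ≈ (F *ˢ (G ∘ suc)) n + F (suc n) * G 0
  *ˢ-suc F G zero    = trans (sym (+-assoc _ _ _)) (trans (+-identityʳ _)
    (+-congʳ (sym (+-identityʳ _))))
  *ˢ-suc F G (suc n) =
    trans (+-congˡ (*ˢ-suc (F ∘ suc) G n)) (sym (+-assoc _ _ _))

  quotient-*ˢ : ∀ F G inv → F 0 ≈ 0# → G 0 ≈ 0# → quotient F G inv *ˢ G ≋ F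
  quotient-*ˢ F G inv F₀≈0 G₀≈0 zero = begin
    quotient F G inv 0 * G 0 + 0#  ≈⟨ +-identityʳ _ ⟩
    quotient F G inv 0 * G 0       ≈⟨ *-congˡ G₀≈0 ⟩
    quotient F G inv 0 * 0#        ≈⟨ zeroʳ _ ⟩
    0#                             ≈⟨ F₀≈0 ⟨
    F 0                            ∎
  quotient-*ˢ F G inv F₀≈0 G₀≈0 (suc n) = begin
    (quotient F G inv *ˢ G) (suc n)
      ≈⟨ *ˢ-suc (quotient F G inv) G n ⟩
    (quotient F G inv *ˢ (G ∘ suc)) n + quotient F G inv (suc n) * G 0
      ≈⟨ +-cong (divide-*ˢ (F ∘ suc) (G ∘ suc) inv n) (trans (*-congˡ G₀≈0) (zeroʳ _)) ⟩
    F (suc n) + 0#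
      ≈⟨ +-identityʳ _ ⟩
    F (suc n) ∎

  -- log (1 + u) = Σ_{n ≥ 1} (-1)ⁿ⁻¹ uⁿ / n
  log1+ : Series
  log1+ zero    = 0#
  log1+ (suc n) = (- 1#) ^ n * 1/ suc n

  -- Li_k(u) / u = Σ_{m ≥ 0} uᵐ / (m + 1)ᵏ
  Li[_]/u : ℤ → Series
  Li[ k ]/u m = 1/ suc m ^ℤ k

  -- The sequence a with F = Σ aₙ tⁿ / n!.
  egfCoefficients : Series → ℕ → Carrier
  egfCoefficients F n = (n !) × F n

module Degenerate
  {c ℓ₁ ℓ₂} (K : HeytingField c ℓ₁ ℓ₂) (char0 : CharacteristicZero K)
  (ƛ : HeytingField.Carrier K) (ƛ#0 : HeytingField._#_ K ƛ (HeytingField.0# K)) where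

  open PowerSeries K char0 public
  open RingProperties ring using (-0#≈0#)
  open SetoidReasoning setoid

  ƛ⁻¹ : Carrier
  ƛ⁻¹ = proj₁ (#0⇒invertible ƛ#0)

  [1+ƛt]^_ : Carrier → Series
  ([1+ƛt]^ a) j = fallingFactorial a j * ƛ ^ j * (1/ (j !)) {{j !≢0}}

  log[1+ƛt] : Series
  log[1+ƛt] = log1+ ∘ˢ (ƛ • t)

  -- (1 + ƛt)^(1/ƛ) - 1
  E-1 : Series
  E-1 = [1+ƛt]^ ƛ⁻¹ -ˢ 1ˢ

  1/1≈1 : 1/ 1 ≈ 1#
  1/1≈1 = begin
    1/ 1                ≈⟨ *-identityʳ _ ⟨
    1/ 1 * 1#           ≈⟨ *-congˡ (+-identityʳ 1#) ⟨
    1/ 1 * (1 × 1#)     ≈⟨ proj₁ (proj₂ (#0⇒invertible (char0 1))) ⟩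
    1#                  ∎

  E-1₁≈1 : E-1 1 ≈ 1#
  E-1₁≈1 = begin
    1# * (ƛ⁻¹ - 0#) * (ƛ * 1#) * 1/ 1 - 0#  ≈⟨ trans (+-congˡ -0#≈0#) (+-identityʳ _) ⟩
    1# * (ƛ⁻¹ - 0#) * (ƛ * 1#) * 1/ 1       ≈⟨ trans (*-congˡ 1/1≈1) (*-identityʳ _) ⟩
    1# * (ƛ⁻¹ - 0#) * (ƛ * 1#)              ≈⟨ *-cong (*-identityˡ _) (*-identityʳ ƛ) ⟩
    (ƛ⁻¹ - 0#) * ƛ                          ≈⟨ *-congʳ (trans (+-congˡ -0#≈0#) (+-identityʳ _)) ⟩
    ƛ⁻¹ * ƛ                                 ≈⟨ proj₁ (proj₂ (#0⇒invertible ƛ#0)) ⟩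
    1#                                      ∎

  E-1₁-invertible : Invertible 1# _*_ (E-1 1)
  E-1₁-invertible =
    1# , trans (*-identityˡ _) E-1₁≈1 , trans (*-identityʳ _) E-1₁≈1

  E-1₀≈0 : E-1 0 ≈ 0#
  E-1₀≈0 = begin
    1# * 1# * 1/ 1 - 1#  ≈⟨ +-congʳ (*-cong (*-identityˡ 1#) 1/1≈1) ⟩
    1# * 1# - 1#         ≈⟨ +-congʳ (*-identityˡ 1#) ⟩
    1# - 1#              ≈⟨ -‿inverseʳ 1# ⟩
    0#                   ∎

  log/ƛ : Series
  log/ƛ = ƛ⁻¹ • log[1+ƛt]

  log/ƛ₀≈0 : log/ƛ 0 ≈ 0#
  log/ƛ₀≈0 = trans (*-congˡ (trans (+-identityʳ _) (zeroˡ 1#))) (zeroʳ ƛ⁻¹)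

  t/E-1 : Series
  t/E-1 = quotient t E-1 E-1₁-invertible

  t/E-1-*ˢ : t/E-1 *ˢ E-1 ≋ t
  t/E-1-*ˢ = quotient-*ˢ t E-1 E-1₁-invertible refl E-1₀≈0

  log/ƛ/E-1 : Series
  log/ƛ/E-1 = quotient log/ƛ E-1 E-1₁-invertible

  log/ƛ/E-1-*ˢ : log/ƛ/E-1 *ˢ E-1 ≋ log/ƛ
  log/ƛ/E-1-*ˢ = quotient-*ˢ log/ƛ E-1 E-1₁-invertible log/ƛ₀≈0 E-1₀≈0

  -- Fully degenerate poly-Bernoulli numbers of index k.
  polyβ : ℤ → ℕ → Carrier
  polyβ k = egfCoefficients (Li[ k ]/u ∘ˢ (1ˢ -ˢ [1+ƛt]^ (- ƛ⁻¹)))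

  -- Carlitz's degenerate Bernoulli polynomials, as functions of x.
  β : ℕ → Carrier → Carrier
  β n x = egfCoefficients (t/E-1 *ˢ [1+ƛt]^ (x * ƛ⁻¹)) n

  b : ℕ → Carrier → Carrier
  b n x = egfCoefficients (log/ƛ/E-1 *ˢ [1+ƛt]^ (x * ƛ⁻¹)) n

{-# OPTIONS --safe #-}

-- Put e = (1 + λt)^(1/λ), U = 1 - 1/e and L = log (1 + λt) / λ.  Since
-- (1 + λt) U′ = 1/e, the chain rule gives Li₁(U) = L and
--   Li₂(U)′ = U′ Li₁(U) / U = (1 + λt)⁻¹ L / (e - 1),
-- the exponential generating function of bₙ(-λ).  Integrating it divides
-- the coefficient of tⁿ by n + 1 and multiplies by t, and t / U is t e / (e - 1),
-- the generating function of βₙ(1); the formula is the product of the two.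
-- Identities between series are checked on derivatives, after multiplying
-- by the cancellable series 1 + λt and e - 1.
module Submission where

open import Defs
open import Algebra.Apartness.Bundles using (HeytingField; HeytingCommutativeRing)
open import Algebra.Bundles using (CommutativeRing)
import Algebra.Construct.Pointwise as Pointwise
import Algebra.Properties.CommutativeMonoid.Mult as CommutativeMonoidMult
import Algebra.Properties.CommutativeSemigroup as CommutativeSemigroupProperties
import Algebra.Properties.Ring as RingProperties
import Algebra.Properties.Semiring.Mult as SemiringMult
import Algebra.Properties.Semiring.Sum as SemiringSum
import Algebra.Solver.Ring.NaturalCoefficients.Default as SemiringSolver
open import Data.Fin.Base using (toℕ)
open import Data.Fin.Properties using (toℕ≤pred[n])
open import Data.Integer.Base using (+_)
open import Data.Nat.Base as ℕ
  using (ℕ; zero; suc; _∸_; _!; _≤_; _<_; z≤n; s≤s; NonZero)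
open import Data.Nat.Combinatorics using (_C_; k![n∸k]!∣n!)
open import Data.Nat.Combinatorics.Specification using (nCk≡n!/k![n-k]!)
open import Data.Nat.DivMod using (m/n*n≡m)
import Data.Nat.Properties as ℕ
open import Data.Product.Base using (_,_; proj₁; proj₂)
open import Function.Base using (_∘_)
import Relation.Binary.PropositionalEquality as ≡
import Relation.Binary.Reasoning.Setoid as SetoidReasoning

-- `_C_` is specified by a quotient of naturals; divisibility makes that quotient exact, so the
-- denominator can be cleared.
nCk*k!*[n∸k]!≡n! : ∀ {n k} → k ≤ n → (n C k) ℕ.* (k ! ℕ.* (n ∸ k) !) ≡.≡ n !
nCk*k!*[n∸k]!≡n! {n} {k} k≤n = ≡.trans
  (≡.cong (ℕ._* (k ! ℕ.* (n ∸ k) !)) (nCk≡n!/k![n-k]! k≤n))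
  (m/n*n≡m (k![n∸k]!∣n! k≤n))
  where instance _ = k ℕ.!* (n ∸ k) !≢0

module SeriesRing {c ℓ₁ ℓ₂} (K : HeytingField c ℓ₁ ℓ₂) (char0 : CharacteristicZero K) where

  open PowerSeries K char0
  open SemiringSum semiring using (sum-replicate-zero; ∑-distrib-+)
  open SemiringMult semiring using (×-congʳ; ×-assoc-*; ×-comm-*)
  open CommutativeMonoidMult +-commutativeMonoid using (×-distrib-+)
  open SetoidReasoning setoid

  K-ring : CommutativeRing c ℓ₁
  K-ring = HeytingCommutativeRing.commutativeRing (HeytingField.heytingCommutativeRing K)

  open SemiringSolver (CommutativeRing.commutativeSemiring K-ring)
    using (solve; _:=_; _:+_; _:*_)

  -- The commutative ring of power series.

  infixl 6 _+ˢ_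

  _+ˢ_ : Series → Series → Series
  (F +ˢ G) n = F n + G n

  0ˢ : Series
  0ˢ _ = 0#

  -- The pattern of the inductions on products: at `suc n` a product unfolds by definition into its
  -- first summand and the coefficient at `n` of the product with `F ∘ suc`, so the left factor is
  -- shifted and the right one stays.
  *ˢ-cong : ∀ {F F′ G G′} → F ≋ F′ → G ≋ G′ → F *ˢ G ≋ F′ *ˢ G′
  *ˢ-cong F≋F′ G≋G′ zero    = +-congʳ (*-cong (F≋F′ 0) (G≋G′ 0))
  *ˢ-cong F≋F′ G≋G′ (suc n) =
    +-cong (*-cong (F≋F′ 0) (G≋G′ (suc n))) (*ˢ-cong (F≋F′ ∘ suc) G≋G′ n)

  -- Unfolding peels the left factor and `*ˢ-suc` peels the right one; the two expansions mirror
  -- each other.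
  *ˢ-comm : ∀ F G → F *ˢ G ≋ G *ˢ F
  *ˢ-comm F G zero    = +-congʳ (*-comm (F 0) (G 0))
  *ˢ-comm F G (suc n) = begin
    F 0 * G (suc n) + ((F ∘ suc) *ˢ G) n  ≈⟨ +-cong (*-comm _ _) (*ˢ-comm (F ∘ suc) G n) ⟩
    G (suc n) * F 0 + (G *ˢ (F ∘ suc)) n  ≈⟨ +-comm _ _ ⟩
    (G *ˢ (F ∘ suc)) n + G (suc n) * F 0  ≈⟨ *ˢ-suc G F n ⟨
    (G *ˢ F) (suc n)                      ∎

  •-*ˢ : ∀ a F G → (a • F) *ˢ G ≋ a • (F *ˢ G)
  •-*ˢ a F G zero    = begin
    a * F 0 * G 0 + 0#    ≈⟨ +-identityʳ _ ⟩
    a * F 0 * G 0         ≈⟨ *-assoc _ _ _ ⟩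
    a * (F 0 * G 0)       ≈⟨ *-congˡ (+-identityʳ _) ⟨
    a * (F 0 * G 0 + 0#)  ∎
  •-*ˢ a F G (suc n) = begin
    a * F 0 * G (suc n) + ((a • (F ∘ suc)) *ˢ G) n  ≈⟨ +-cong (*-assoc _ _ _) (•-*ˢ a (F ∘ suc) G n) ⟩
    a * (F 0 * G (suc n)) + a * ((F ∘ suc) *ˢ G) n  ≈⟨ distribˡ _ _ _ ⟨
    a * (F 0 * G (suc n) + ((F ∘ suc) *ˢ G) n)      ∎

  *ˢ-• : ∀ a F G → F *ˢ (a • G) ≋ a • (F *ˢ G)
  *ˢ-• a F G n = trans (*ˢ-comm F (a • G) n) (trans (•-*ˢ a G F n) (*-congˡ (*ˢ-comm G F n)))

  *ˢ-distribʳ : ∀ H F G → (F +ˢ G) *ˢ H ≋ (F *ˢ H) +ˢ (G *ˢ H)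
  *ˢ-distribʳ H F G zero    = begin
    (F 0 + G 0) * H 0 + 0#            ≈⟨ +-identityʳ _ ⟩
    (F 0 + G 0) * H 0                 ≈⟨ distribʳ _ _ _ ⟩
    F 0 * H 0 + G 0 * H 0             ≈⟨ +-cong (+-identityʳ _) (+-identityʳ _) ⟨
    F 0 * H 0 + 0# + (G 0 * H 0 + 0#) ∎
  *ˢ-distribʳ H F G (suc n) = begin
    (F 0 + G 0) * H (suc n) + (((F ∘ suc) +ˢ (G ∘ suc)) *ˢ H) n
      ≈⟨ +-congˡ (*ˢ-distribʳ H (F ∘ suc) (G ∘ suc) n) ⟩
    (F 0 + G 0) * H (suc n) + (((F ∘ suc) *ˢ H) n + ((G ∘ suc) *ˢ H) n)
      ≈⟨ solve 5 (λ f g h x y → (f :+ g) :* h :+ (x :+ y) := f :* h :+ x :+ (g :* h :+ y))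
           refl _ _ _ _ _ ⟩
    F 0 * H (suc n) + ((F ∘ suc) *ˢ H) n + (G 0 * H (suc n) + ((G ∘ suc) *ˢ H) n)
      ∎

  *ˢ-distribˡ : ∀ H F G → H *ˢ (F +ˢ G) ≋ (H *ˢ F) +ˢ (H *ˢ G)
  *ˢ-distribˡ H F G n = begin
    (H *ˢ (F +ˢ G)) n           ≈⟨ *ˢ-comm H (F +ˢ G) n ⟩
    ((F +ˢ G) *ˢ H) n           ≈⟨ *ˢ-distribʳ H F G n ⟩
    (F *ˢ H) n + (G *ˢ H) n     ≈⟨ +-cong (*ˢ-comm F H n) (*ˢ-comm G H n) ⟩
    (H *ˢ F) n + (H *ˢ G) n     ∎

  *ˢ-assoc : ∀ F G H → (F *ˢ G) *ˢ H ≋ F *ˢ (G *ˢ H)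
  *ˢ-assoc F G H zero    = begin
    (F 0 * G 0 + 0#) * H 0 + 0#    ≈⟨ +-congʳ (*-congʳ (+-identityʳ _)) ⟩
    F 0 * G 0 * H 0 + 0#           ≈⟨ +-congʳ (*-assoc _ _ _) ⟩
    F 0 * (G 0 * H 0) + 0#         ≈⟨ +-congʳ (*-congˡ (+-identityʳ _)) ⟨
    F 0 * (G 0 * H 0 + 0#) + 0#    ∎
  *ˢ-assoc F G H (suc n) = begin
    -- The shifted product `(F *ˢ G) ∘ suc` is by definition the sum
    -- `(F 0 • (G ∘ suc)) +ˢ ((F ∘ suc) *ˢ G)`.
    (F 0 * G 0 + 0#) * H (suc n) + (((F 0 • (G ∘ suc)) +ˢ ((F ∘ suc) *ˢ G)) *ˢ H) n
      ≈⟨ +-cong (*-congʳ (+-identityʳ _))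
                (trans (*ˢ-distribʳ H (F 0 • (G ∘ suc)) ((F ∘ suc) *ˢ G) n)
                  (+-cong (•-*ˢ (F 0) (G ∘ suc) H n) (*ˢ-assoc (F ∘ suc) G H n))) ⟩
    F 0 * G 0 * H (suc n) + (F 0 * ((G ∘ suc) *ˢ H) n + ((F ∘ suc) *ˢ (G *ˢ H)) n)
      ≈⟨ solve 5 (λ f g h x y → f :* g :* h :+ (f :* x :+ y) := f :* (g :* h :+ x) :+ y) refl _ _ _ _ _ ⟩
    F 0 * (G 0 * H (suc n) + ((G ∘ suc) *ˢ H) n) + ((F ∘ suc) *ˢ (G *ˢ H)) n
      ∎

  0ˢ-*ˢ : ∀ F → 0ˢ *ˢ F ≋ 0ˢ
  0ˢ-*ˢ F zero    = trans (+-identityʳ _) (zeroˡ _)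
  0ˢ-*ˢ F (suc n) = trans (+-cong (zeroˡ _) (0ˢ-*ˢ F n)) (+-identityʳ _)

  *ˢ-identityˡ : ∀ F → 1ˢ *ˢ F ≋ F
  *ˢ-identityˡ F zero    = trans (+-identityʳ _) (*-identityˡ _)
  *ˢ-identityˡ F (suc n) = trans (+-cong (*-identityˡ _) (0ˢ-*ˢ F n)) (+-identityʳ _)

  seriesRing : CommutativeRing c ℓ₁
  seriesRing = record
    { Carrier = Series
    ; _≈_ = _≋_
    ; _+_ = _+ˢ_
    ; _*_ = _*ˢ_
    ; -_ = λ F n → - F n
    ; 0# = 0ˢ
    ; 1# = 1ˢ
    ; isCommutativeRing = record
      { isRing = record
        { +-isAbelianGroup = Pointwise.isAbelianGroup ℕ +-isAbelianGroup
        ; *-cong = *ˢ-cong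
        ; *-assoc = *ˢ-assoc
        ; *-identity = *ˢ-identityˡ , λ F n → trans (*ˢ-comm F 1ˢ n) (*ˢ-identityˡ F n)
        ; distrib = *ˢ-distribˡ , *ˢ-distribʳ
        }
      ; *-comm = *ˢ-comm
      }
    }

  module 𝕊 = CommutativeRing seriesRing

  module ≋-Reasoning = SetoidReasoning 𝕊.setoid

  -- Cancellation of factors in products of series.

  t*-suc : ∀ F n → (t *ˢ F) (suc n) ≈ F n
  t*-suc F n = trans (+-cong (zeroˡ _) (*ˢ-identityˡ F n)) (+-identityˡ _)

  t*-zero : ∀ F → (t *ˢ F) 0 ≈ 0#
  t*-zero F = trans (+-identityʳ _) (zeroˡ _)

  t*-cancelˡ : ∀ {F G} → t *ˢ F ≋ t *ˢ G → F ≋ G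
  t*-cancelˡ {F} {G} tF≋tG n = begin
    F n               ≈⟨ t*-suc F n ⟨
    (t *ˢ F) (suc n)  ≈⟨ tF≋tG (suc n) ⟩
    (t *ˢ G) (suc n)  ≈⟨ t*-suc G n ⟩
    G n               ∎

  *ˢ-cancelˡ-inverse : ∀ F′ F {G H} → F′ *ˢ F ≋ 1ˢ → F *ˢ G ≋ F *ˢ H → G ≋ H
  *ˢ-cancelˡ-inverse F′ F {G} {H} F′F≋1 FG≋FH = R.begin
    G                 R.≈⟨ 𝕊.*-identityˡ G ⟨
    1ˢ *ˢ G           R.≈⟨ *ˢ-cong F′F≋1 (𝕊.refl {G}) ⟨
    F′ *ˢ F *ˢ G      R.≈⟨ *ˢ-assoc F′ F G ⟩
    F′ *ˢ (F *ˢ G)    R.≈⟨ *ˢ-cong (𝕊.refl {F′}) FG≋FH ⟩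
    F′ *ˢ (F *ˢ H)    R.≈⟨ *ˢ-assoc F′ F H ⟨
    F′ *ˢ F *ˢ H      R.≈⟨ *ˢ-cong F′F≋1 (𝕊.refl {H}) ⟩
    1ˢ *ˢ H           R.≈⟨ 𝕊.*-identityˡ H ⟩
    H                 R.∎
    where module R = ≋-Reasoning

  -- Division by positive integers in characteristic zero.

  ×1/ : ∀ n .{{_ : NonZero n}} → (n × 1#) * 1/ n ≈ 1#
  ×1/ n = proj₂ (proj₂ (#0⇒invertible (char0 n)))

  ×-as-* : ∀ n x → n × x ≈ (n × 1#) * x
  ×-as-* n x = trans (×-congʳ n (sym (*-identityˡ x))) (sym (×-assoc-* n 1# x))

  ×-1/-cancel : ∀ n .{{_ : NonZero n}} x → n × (x * 1/ n) ≈ x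
  ×-1/-cancel n x = begin
    n × (x * 1/ n)          ≈⟨ ×-as-* n _ ⟩
    (n × 1#) * (x * 1/ n)   ≈⟨ solve 3 (λ a b c → a :* (b :* c) := b :* (a :* c)) refl _ _ _ ⟩
    x * ((n × 1#) * 1/ n)   ≈⟨ *-congˡ (×1/ n) ⟩
    x * 1#                  ≈⟨ *-identityʳ x ⟩
    x                       ∎

  ×-cancelˡ : ∀ n .{{_ : NonZero n}} {x y} → n × x ≈ n × y → x ≈ y
  ×-cancelˡ n {x} {y} nx≈ny = begin
    x                ≈⟨ ×-1/-cancel n x ⟨
    n × (x * 1/ n)   ≈⟨ ×-assoc-* n x _ ⟨
    (n × x) * 1/ n   ≈⟨ *-congʳ nx≈ny ⟩
    (n × y) * 1/ n   ≈⟨ ×-assoc-* n y _ ⟩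
    n × (y * 1/ n)   ≈⟨ ×-1/-cancel n y ⟩
    y                ∎

  -- Differentiation.

  D : Series → Series
  D F n = suc n × F (suc n)

  -- The Euler operator t d/dt. Unlike `D` it keeps indices in place, which suits induction on
  -- products; `θ F ∘ suc` is `D F` by definition.
  θ : Series → Series
  θ F n = n × F n

  θ-*ˢ : ∀ F G → θ (F *ˢ G) ≋ (θ F *ˢ G) +ˢ (F *ˢ θ G)
  θ-*ˢ F G zero    = sym (begin
    0# * G 0 + 0# + (F 0 * 0# + 0#)  ≈⟨ +-cong (+-identityʳ _) (+-identityʳ _) ⟩
    0# * G 0 + F 0 * 0#              ≈⟨ +-cong (zeroˡ _) (zeroʳ _) ⟩
    0# + 0#                          ≈⟨ +-identityʳ _ ⟩
    0#                               ∎)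
  θ-*ˢ F G (suc n) = begin
    suc n × (F 0 * G (suc n) + (F⁺ *ˢ G) n)
      -- On the tail, `suc n` copies are one copy plus `n` copies, and the latter form a `θ` to
      -- which the induction hypothesis applies. The spare copy is absorbed at the end, since
      -- `θ F ∘ suc` is `F⁺ +ˢ θ F⁺`.
      ≈⟨ ×-distrib-+ _ _ (suc n) ⟩
    suc n × (F 0 * G (suc n)) + ((F⁺ *ˢ G) n + θ (F⁺ *ˢ G) n)
      ≈⟨ +-cong (sym (×-comm-* (suc n) _ _)) (+-congˡ (θ-*ˢ F⁺ G n)) ⟩
    F 0 * θ G (suc n) + ((F⁺ *ˢ G) n + ((θ F⁺ *ˢ G) n + (F⁺ *ˢ θ G) n))
      ≈⟨ solve 4 (λ a b c d → a :+ (b :+ (c :+ d)) := b :+ c :+ (a :+ d)) refl _ _ _ _ ⟩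
    (F⁺ *ˢ G) n + (θ F⁺ *ˢ G) n + (F 0 * θ G (suc n) + (F⁺ *ˢ θ G) n)
      ≈⟨ +-congʳ (*ˢ-distribʳ G F⁺ (θ F⁺) n) ⟨
    ((θ F ∘ suc) *ˢ G) n + (F *ˢ θ G) (suc n)
      ≈⟨ +-congʳ (trans (+-congʳ (zeroˡ _)) (+-identityˡ _)) ⟨
    (θ F *ˢ G) (suc n) + (F *ˢ θ G) (suc n)
      ∎
    where F⁺ = F ∘ suc

  -- The Leibniz rule for `θ` read one index higher: the boundary terms vanish because `θ` kills
  -- constant terms.
  D-*ˢ : ∀ F G → D (F *ˢ G) ≋ (D F *ˢ G) +ˢ (F *ˢ D G)
  D-*ˢ F G n = begin
    θ (F *ˢ G) (suc n)                         ≈⟨ θ-*ˢ F G (suc n) ⟩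
    (θ F *ˢ G) (suc n) + (F *ˢ θ G) (suc n)    ≈⟨ +-congˡ (*ˢ-suc F (θ G) n) ⟩
    0# * G (suc n) + (D F *ˢ G) n + ((F *ˢ D G) n + F (suc n) * 0#)
      ≈⟨ +-cong (trans (+-congʳ (zeroˡ _)) (+-identityˡ _))
                (trans (+-congˡ (zeroʳ _)) (+-identityʳ _)) ⟩
    (D F *ˢ G) n + (F *ˢ D G) n                ∎

  D-cong : ∀ {F G} → F ≋ G → D F ≋ D G
  D-cong F≋G n = ×-congʳ (suc n) (F≋G (suc n))

  D-+ˢ : ∀ F G → D (F +ˢ G) ≋ D F +ˢ D G
  D-+ˢ F G n = ×-distrib-+ _ _ (suc n)

  D-• : ∀ a F → D (a • F) ≋ a • D F
  D-• a F n = sym (×-comm-* (suc n) a _)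

  D-1ˢ : D 1ˢ ≋ 0ˢ
  D-1ˢ n = trans (×-as-* (suc n) 0#) (zeroʳ _)

  -- An initial value and a derivative determine a series, because `suc n` can be cancelled in
  -- characteristic zero.
  D-injective : ∀ {F G} → F 0 ≈ G 0 → D F ≋ D G → F ≋ G
  D-injective F₀≈G₀ DF≋DG zero    = F₀≈G₀
  D-injective F₀≈G₀ DF≋DG (suc n) = ×-cancelˡ (suc n) (DF≋DG n)

  t*-D : ∀ F → t *ˢ D F ≋ θ F
  t*-D F zero    = t*-zero (D F)
  t*-D F (suc n) = t*-suc (D F) n

  -- Finite sums with summands indexed by naturals, and their truncation.

  sumBelow : ℕ → (ℕ → Carrier) → Carrier
  sumBelow n A = ∑[ m < n ] A (toℕ m)

  sumBelow-cong : ∀ n {A B : ℕ → Carrier} → (∀ m → A m ≈ B m) → sumBelow n A ≈ sumBelow n B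
  sumBelow-cong zero    A≈B = refl
  sumBelow-cong (suc n) A≈B = +-cong (A≈B 0) (sumBelow-cong n (A≈B ∘ suc))

  sumBelow-+ : ∀ n (A B : ℕ → Carrier) →
    sumBelow n (λ m → A m + B m) ≈ sumBelow n A + sumBelow n B
  sumBelow-+ n A B = ∑-distrib-+ {n} (A ∘ toℕ) (B ∘ toℕ)

  sumBelow-0 : ∀ n {A : ℕ → Carrier} → (∀ m → A m ≈ 0#) → sumBelow n A ≈ 0#
  sumBelow-0 n A≈0 = trans (sumBelow-cong n A≈0) (sum-replicate-zero n)

  sumBelow-truncate : ∀ {n N} {A : ℕ → Carrier} → n ≤ N → (∀ m → n ≤ m → A m ≈ 0#) →
    sumBelow N A ≈ sumBelow n A
  sumBelow-truncate {N = N} z≤n       A≈0 = sumBelow-0 N λ m → A≈0 m z≤n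
  sumBelow-truncate         (s≤s n≤N) A≈0 =
    +-congˡ (sumBelow-truncate n≤N λ m n≤m → A≈0 (suc m) (s≤s n≤m))

  *ˢ-sumBelow : ∀ N G (a : ℕ → Carrier) (P : ℕ → Series) →
    G *ˢ (λ j → sumBelow N (λ m → a m * P m j)) ≋ (λ j → sumBelow N (λ m → a m * (G *ˢ P m) j))
  *ˢ-sumBelow zero    G a P n = trans (*ˢ-comm G 0ˢ n) (0ˢ-*ˢ G n)
  *ˢ-sumBelow (suc N) G a P n = begin
    (G *ˢ ((a 0 • P 0) +ˢ rest)) n          ≈⟨ *ˢ-distribˡ G (a 0 • P 0) rest n ⟩
    (G *ˢ (a 0 • P 0)) n + (G *ˢ rest) n    ≈⟨ +-cong (*ˢ-• (a 0) G (P 0) n) (*ˢ-sumBelow N G (a ∘ suc) (P ∘ suc) n) ⟩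
    a 0 * (G *ˢ P 0) n + sumBelow N (λ m → a (suc m) * (G *ˢ P (suc m)) n)  ∎
    where
    rest : Series
    rest j = sumBelow N (λ m → a (suc m) * P (suc m) j)

  -- Only coefficients up to `n` of the right factor enter. Hence series that agree merely up to a
  -- bound, such as differently truncated compositions, can be exchanged inside a product.
  *ˢ-congʳ-≤ : ∀ F {G H} n → (∀ j → j ≤ n → G j ≈ H j) → (F *ˢ G) n ≈ (F *ˢ H) n
  *ˢ-congʳ-≤ F zero    G≈H = +-congʳ (*-congˡ (G≈H 0 z≤n))
  *ˢ-congʳ-≤ F (suc n) G≈H =
    +-cong (*-congˡ (G≈H (suc n) ℕ.≤-refl))
           (*ˢ-congʳ-≤ (F ∘ suc) n λ j j≤n → G≈H j (ℕ.m≤n⇒m≤1+n j≤n))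

  -- Composition of series and the chain rule.

  ∘ˢ-congˡ : ∀ {F G} U → F ≋ G → F ∘ˢ U ≋ G ∘ˢ U
  ∘ˢ-congˡ U F≋G n = sumBelow-cong (suc n) λ m → *-congʳ {(U ^ˢ m) n} (F≋G m)

  ∘ˢ-+ˢ : ∀ F G U → (F +ˢ G) ∘ˢ U ≋ (F ∘ˢ U) +ˢ (G ∘ˢ U)
  ∘ˢ-+ˢ F G U n = trans
    (sumBelow-cong (suc n) λ m → distribʳ ((U ^ˢ m) n) (F m) (G m))
    (sumBelow-+ (suc n) (λ m → F m * (U ^ˢ m) n) (λ m → G m * (U ^ˢ m) n))

  0ˢ-∘ˢ : ∀ U → 0ˢ ∘ˢ U ≋ 0ˢ
  0ˢ-∘ˢ U n = sumBelow-0 (suc n) λ m → zeroˡ ((U ^ˢ m) n)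

  module _ (U : Series) (U₀≈0 : U 0 ≈ 0#) where

    *ˢ-zero : ∀ F → (U *ˢ F) 0 ≈ 0#
    *ˢ-zero F = trans (+-identityʳ _) (trans (*-congʳ U₀≈0) (zeroˡ _))

    *ˢ-suc′ : ∀ F n → (U *ˢ F) (suc n) ≈ ((U ∘ suc) *ˢ F) n
    *ˢ-suc′ F n = trans (+-congʳ (trans (*-congʳ U₀≈0) (zeroˡ _))) (+-identityˡ _)

    -- Each factor `U` contributes at least one power of t.
    ^ˢ-order : ∀ m n → n < m → (U ^ˢ m) n ≈ 0#
    ^ˢ-order (suc m) zero    _         = *ˢ-zero (U ^ˢ m)
    ^ˢ-order (suc m) (suc n) (s≤s n<m) = begin
      (U *ˢ U ^ˢ m) (suc n)        ≈⟨ *ˢ-suc′ (U ^ˢ m) n ⟩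
      ((U ∘ suc) *ˢ U ^ˢ m) n      ≈⟨ *ˢ-congʳ-≤ (U ∘ suc) n (λ j j≤n → ^ˢ-order m j (ℕ.≤-<-trans j≤n n<m)) ⟩
      ((U ∘ suc) *ˢ 0ˢ) n          ≈⟨ *ˢ-comm (U ∘ suc) 0ˢ n ⟩
      (0ˢ *ˢ (U ∘ suc)) n          ≈⟨ 0ˢ-*ˢ (U ∘ suc) n ⟩
      0#                           ∎

    -- Horner's rule: the term m = 0 is split off and one `U` is drawn out of all other powers. It
    -- trades the index-dependent truncation in `_∘ˢ_` for a recursion on series.
    ∘ˢ-horner : ∀ F → F ∘ˢ U ≋ (F 0 • 1ˢ) +ˢ (U *ˢ ((F ∘ suc) ∘ˢ U))
    ∘ˢ-horner F zero    = +-congˡ (sym (*ˢ-zero ((F ∘ suc) ∘ˢ U)))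
    ∘ˢ-horner F (suc n) = +-congˡ (begin
      sumBelow (suc n) (λ m → F (suc m) * (U *ˢ U ^ˢ m) (suc n))
        ≈⟨ sumBelow-cong (suc n) (λ m → *-congˡ {F (suc m)} (*ˢ-suc′ (U ^ˢ m) n)) ⟩
      sumBelow (suc n) (λ m → F (suc m) * ((U ∘ suc) *ˢ U ^ˢ m) n)
        ≈⟨ *ˢ-sumBelow (suc n) (U ∘ suc) (F ∘ suc) (U ^ˢ_) n ⟨
      ((U ∘ suc) *ˢ (λ j → sumBelow (suc n) (λ m → F (suc m) * (U ^ˢ m) j))) n
        -- The inner sum runs to the same `n` at every index `j ≤ n`, while the composition stops at
        -- `j`; the surplus powers of `U` have order above `j`.
        ≈⟨ *ˢ-congʳ-≤ (U ∘ suc) {λ j → sumBelow (suc n) (λ m → F (suc m) * (U ^ˢ m) j)} n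
             (λ j j≤n → sumBelow-truncate (s≤s j≤n)
               λ m j<m → trans (*-congˡ {F (suc m)} (^ˢ-order m j j<m)) (zeroʳ (F (suc m)))) ⟩
      ((U ∘ suc) *ˢ ((F ∘ suc) ∘ˢ U)) n
        ≈⟨ *ˢ-suc′ ((F ∘ suc) ∘ˢ U) n ⟨
      (U *ˢ ((F ∘ suc) ∘ˢ U)) (suc n)
        ∎)

    -- Since U has no constant term, each recursion determines the n-th
    -- coefficient from strictly lower ones.
    horner-unique : (X Y R : Series → Series) →
      (∀ F → X F ≋ R F +ˢ (U *ˢ X (F ∘ suc))) →
      (∀ F → Y F ≋ R F +ˢ (U *ˢ Y (F ∘ suc))) →
      ∀ F → X F ≋ Y F
    horner-unique X Y R X-rec Y-rec F n = agree n F n ℕ.≤-refl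
      where
      step : ∀ F n → (U *ˢ X (F ∘ suc)) n ≈ (U *ˢ Y (F ∘ suc)) n → X F n ≈ Y F n
      step F n eq = trans (X-rec F n) (trans (+-congˡ eq) (sym (Y-rec F n)))

      agree : ∀ N F n → n ≤ N → X F n ≈ Y F n
      agree N       F zero    _         =
        step F 0 (trans (*ˢ-zero (X (F ∘ suc))) (sym (*ˢ-zero (Y (F ∘ suc)))))
      agree (suc N) F (suc n) (s≤s n≤N) = step F (suc n) (begin
        (U *ˢ X (F ∘ suc)) (suc n)        ≈⟨ *ˢ-suc′ (X (F ∘ suc)) n ⟩
        ((U ∘ suc) *ˢ X (F ∘ suc)) n
          ≈⟨ *ˢ-congʳ-≤ (U ∘ suc) n (λ j j≤n → agree N (F ∘ suc) j (ℕ.≤-trans j≤n n≤N)) ⟩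
        ((U ∘ suc) *ˢ Y (F ∘ suc)) n      ≈⟨ *ˢ-suc′ (Y (F ∘ suc)) n ⟨
        (U *ˢ Y (F ∘ suc)) (suc n)        ∎)

    ∘ˢ-0 : ∀ {F} → F 0 ≈ 0# → F ∘ˢ U ≋ U *ˢ ((F ∘ suc) ∘ˢ U)
    ∘ˢ-0 {F} F₀≈0 n = trans (∘ˢ-horner F n)
      (trans (+-congʳ (trans (*-congʳ F₀≈0) (zeroˡ _))) (+-identityˡ _))

    -- Both sides satisfy one Horner recursion, the left by the Leibniz rule applied to `∘ˢ-horner`,
    -- the right by splitting `D F`; `horner-unique` then identifies them.
    D-∘ˢ : ∀ F → D (F ∘ˢ U) ≋ (D F ∘ˢ U) *ˢ D U
    D-∘ˢ = horner-unique _ _ (λ F → ((F ∘ suc) ∘ˢ U) *ˢ D U)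
      (λ F → R.begin
        D (F ∘ˢ U)
          R.≈⟨ D-cong (∘ˢ-horner F) ⟩
        D ((F 0 • 1ˢ) +ˢ (U *ˢ ((F ∘ suc) ∘ˢ U)))
          R.≈⟨ D-+ˢ (F 0 • 1ˢ) (U *ˢ ((F ∘ suc) ∘ˢ U)) ⟩
        D (F 0 • 1ˢ) +ˢ D (U *ˢ ((F ∘ suc) ∘ˢ U))
          R.≈⟨ 𝕊.+-cong
                 (λ n → trans (D-• (F 0) 1ˢ n) (trans (*-congˡ (D-1ˢ n)) (zeroʳ _)))
                 (D-*ˢ U ((F ∘ suc) ∘ˢ U)) ⟩
        0ˢ +ˢ (D U *ˢ ((F ∘ suc) ∘ˢ U) +ˢ U *ˢ D ((F ∘ suc) ∘ˢ U))
          R.≈⟨ 𝕊.+-identityˡ _ ⟩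
        D U *ˢ ((F ∘ suc) ∘ˢ U) +ˢ U *ˢ D ((F ∘ suc) ∘ˢ U)
          R.≈⟨ 𝕊.+-congʳ (*ˢ-comm (D U) ((F ∘ suc) ∘ˢ U)) ⟩
        ((F ∘ suc) ∘ˢ U) *ˢ D U +ˢ U *ˢ D ((F ∘ suc) ∘ˢ U)
          R.∎)
      (λ F → R.begin
        -- This is `D F` unfolded. Its second summand has no constant term, and the shift of that
        -- summand is `D (F ∘ suc)`.
        (((F ∘ suc) +ˢ θ (F ∘ suc)) ∘ˢ U) *ˢ D U
          R.≈⟨ *ˢ-cong (∘ˢ-+ˢ (F ∘ suc) (θ (F ∘ suc)) U) (𝕊.refl {D U}) ⟩
        (((F ∘ suc) ∘ˢ U) +ˢ (θ (F ∘ suc) ∘ˢ U)) *ˢ D U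
          R.≈⟨ *ˢ-distribʳ (D U) ((F ∘ suc) ∘ˢ U) (θ (F ∘ suc) ∘ˢ U) ⟩
        ((F ∘ suc) ∘ˢ U) *ˢ D U +ˢ (θ (F ∘ suc) ∘ˢ U) *ˢ D U
          R.≈⟨ 𝕊.+-congˡ {((F ∘ suc) ∘ˢ U) *ˢ D U} (R.begin
            (θ (F ∘ suc) ∘ˢ U) *ˢ D U          R.≈⟨ *ˢ-cong (∘ˢ-0 {θ (F ∘ suc)} refl) (𝕊.refl {D U}) ⟩
            U *ˢ (D (F ∘ suc) ∘ˢ U) *ˢ D U     R.≈⟨ *ˢ-assoc U (D (F ∘ suc) ∘ˢ U) (D U) ⟩
            U *ˢ ((D (F ∘ suc) ∘ˢ U) *ˢ D U)   R.∎) ⟩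
        ((F ∘ suc) ∘ˢ U) *ˢ D U +ˢ U *ˢ ((D (F ∘ suc) ∘ˢ U) *ˢ D U)
          R.∎)
      where module R = ≋-Reasoning


module PolyBernoulli
  {c ℓ₁ ℓ₂} (K : HeytingField c ℓ₁ ℓ₂) (char0 : CharacteristicZero K)
  (ƛ : HeytingField.Carrier K) (ƛ#0 : HeytingField._#_ K ƛ (HeytingField.0# K)) where

  open Degenerate K char0 ƛ ƛ#0
  open SeriesRing K char0
  open SemiringSum semiring using (sum-cong-≋; *-distribˡ-sum)
  open SemiringMult semiring using (×-congʳ; ×-congˡ; ×-assocˡ; ×-assoc-*; ×-comm-*)
  open RingProperties ring using (-‿distribˡ-*; -1*x≈-x)
  module 𝕊ₚ = RingProperties 𝕊.ring
  module 𝕊* = CommutativeSemigroupProperties 𝕊.*-commutativeSemigroup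
  open SetoidReasoning setoid
  module R = ≋-Reasoning
  open SemiringSolver (CommutativeRing.commutativeSemiring K-ring)
    using (solve; _:=_; _:+_; _:*_)
  open SemiringSolver 𝕊.commutativeSemiring
    using () renaming (solve to solveˢ; _:=_ to _:=ˢ_; _:+_ to _:+ˢ_; _:*_ to _:*ˢ_)

  -- Powers of 1 + λt and their differential equation.

  ƛ⁻¹*ƛ : ƛ⁻¹ * ƛ ≈ 1#
  ƛ⁻¹*ƛ = proj₁ (proj₂ (#0⇒invertible ƛ#0))

  P : Carrier → Series
  P = [1+ƛt]^_

  1+ƛt : Series
  1+ƛt = 1ˢ +ˢ ƛ • t

  1+ƛt-*ˢ : ∀ F → 1+ƛt *ˢ F ≋ F +ˢ ƛ • (t *ˢ F)
  1+ƛt-*ˢ F n = trans (*ˢ-distribʳ F 1ˢ (ƛ • t) n) (+-cong (*ˢ-identityˡ F n) (•-*ˢ ƛ t F n))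

  ×-1/ : ∀ n .{{_ : NonZero n}} → n × 1/ n ≈ 1#
  ×-1/ n = trans (×-as-* n _) (×1/ n)

  -- Reciprocals are witnesses of invertibility and do not compute, so the two sides are compared
  -- after multiplication by `n !`.
  ×-1/! : ∀ n → suc n × (1/ (suc n !)) {{suc n ℕ.!≢0}} ≈ (1/ (n !)) {{n ℕ.!≢0}}
  ×-1/! n = ×-cancelˡ (n !) {{n ℕ.!≢0}} (begin
    (n !) × (suc n × x)      ≈⟨ ×-assocˡ x (n !) (suc n) ⟩
    (n ! ℕ.* suc n) × x      ≈⟨ ×-congˡ {x} (ℕ.*-comm (n !) (suc n)) ⟩
    (suc n !) × x            ≈⟨ ×-1/ (suc n !) {{suc n ℕ.!≢0}} ⟩
    1#                       ≈⟨ ×-1/ (n !) {{n ℕ.!≢0}} ⟨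
    (n !) × (1/ (n !)) {{n ℕ.!≢0}}  ∎)
    where x = (1/ (suc n !)) {{suc n ℕ.!≢0}}

  P-0 : ∀ a → P a 0 ≈ 1#
  P-0 a = trans (*-cong (*-identityˡ 1#) 1/1≈1) (*-identityˡ 1#)

  fallingFactorial-cong : ∀ {a b} → a ≈ b → ∀ j → fallingFactorial a j ≈ fallingFactorial b j
  fallingFactorial-cong a≈b zero    = refl
  fallingFactorial-cong a≈b (suc j) = *-cong (fallingFactorial-cong a≈b j) (+-congʳ a≈b)

  P-cong : ∀ {a b} → a ≈ b → P a ≋ P b
  P-cong a≈b j = *-congʳ (*-congʳ (fallingFactorial-cong a≈b j))

  D-P : ∀ a n → D (P a) n ≈ (a - n × 1#) * ƛ * P a n
  D-P a n = begin
    suc n × (f * y * (ƛ * ƛ ^ n) * (1/ (suc n !)) {{suc n ℕ.!≢0}})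
      ≈⟨ ×-comm-* (suc n) _ _ ⟨
    f * y * (ƛ * ƛ ^ n) * (suc n × (1/ (suc n !)) {{suc n ℕ.!≢0}})
      ≈⟨ *-congˡ (×-1/! n) ⟩
    f * y * (ƛ * ƛ ^ n) * (1/ (n !)) {{n ℕ.!≢0}}
      ≈⟨ solve 5 (λ f y l p r → f :* y :* (l :* p) :* r := y :* l :* (f :* p :* r)) refl _ _ _ _ _ ⟩
    y * ƛ * P a n
      ∎
    where
    f = fallingFactorial a n
    y = a - n × 1#

  -- In `D-P` the coefficient carries `a - n`; the extra part λt of the multiplier acts as `ƛ • θ`
  -- and restores the missing `n`. This equation replaces Vandermonde's identity when powers are
  -- multiplied below.
  1+ƛt-D-P : ∀ a → 1+ƛt *ˢ D (P a) ≋ (a * ƛ) • P a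
  1+ƛt-D-P a n = begin
    (1+ƛt *ˢ D (P a)) n                         ≈⟨ 1+ƛt-*ˢ (D (P a)) n ⟩
    D (P a) n + ƛ * (t *ˢ D (P a)) n            ≈⟨ +-cong (D-P a n) (*-congˡ (trans (t*-D (P a) n) (×-as-* n _))) ⟩
    (a - n × 1#) * ƛ * p + ƛ * ((n × 1#) * p)
      ≈⟨ solve 5 (λ a m k l p → (a :+ m) :* l :* p :+ l :* (k :* p) := (a :+ (m :+ k)) :* l :* p)
           refl a (- (n × 1#)) (n × 1#) ƛ p ⟩
    (a + (- (n × 1#) + n × 1#)) * ƛ * p
      ≈⟨ *-congʳ (*-congʳ (trans (+-congˡ (-‿inverseˡ _)) (+-identityʳ a))) ⟩
    a * ƛ * p                                   ∎
    where p = P a n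

  D-t : D t ≋ 1ˢ
  D-t zero    = +-identityʳ 1#
  D-t (suc n) = trans (×-as-* (suc (suc n)) 0#) (zeroʳ _)

  D-ƛt : D (ƛ • t) ≋ ƛ • 1ˢ
  D-ƛt n = trans (D-• ƛ t n) (*-congˡ (D-t n))

  D-1+ƛt : D 1+ƛt ≋ ƛ • 1ˢ
  D-1+ƛt n = trans (D-+ˢ 1ˢ (ƛ • t) n) (trans (+-cong (D-1ˢ n) (D-ƛt n)) (+-identityˡ _))

  D-0⇒1 : ∀ {F} → F 0 ≈ 1# → D F ≋ 0ˢ → F ≋ 1ˢ
  D-0⇒1 F₀≈1 DF≋0 = D-injective F₀≈1 λ n → trans (DF≋0 n) (sym (D-1ˢ n))

  *ˢ-head : ∀ {F G} → F 0 ≈ 1# → G 0 ≈ 1# → (F *ˢ G) 0 ≈ 1#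
  *ˢ-head F₀≈1 G₀≈1 = trans (+-identityʳ _) (trans (*-cong F₀≈1 G₀≈1) (*-identityˡ 1#))

  -- The exponent equals -1 but is left unreduced, so that it matches the definition of `b` at `- ƛ`
  -- literally.
  [1+ƛt]⁻¹ : Series
  [1+ƛt]⁻¹ = P (- ƛ * ƛ⁻¹)

  -- The product has constant term one, and by the differential equation its derivative is a series
  -- minus itself.
  1+ƛt-inverseʳ : 1+ƛt *ˢ [1+ƛt]⁻¹ ≋ 1ˢ
  1+ƛt-inverseʳ = D-0⇒1
    (*ˢ-head {1+ƛt} {[1+ƛt]⁻¹} (trans (+-congˡ (zeroʳ ƛ)) (+-identityʳ 1#)) (P-0 (- ƛ * ƛ⁻¹)))
    λ n → begin
      D (1+ƛt *ˢ [1+ƛt]⁻¹) n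
        ≈⟨ D-*ˢ 1+ƛt [1+ƛt]⁻¹ n ⟩
      (D 1+ƛt *ˢ [1+ƛt]⁻¹) n + (1+ƛt *ˢ D [1+ƛt]⁻¹) n
        ≈⟨ +-cong (trans (*ˢ-cong D-1+ƛt (𝕊.refl {[1+ƛt]⁻¹}) n)
             (trans (•-*ˢ ƛ 1ˢ [1+ƛt]⁻¹ n) (*-congˡ (*ˢ-identityˡ [1+ƛt]⁻¹ n))))
             (1+ƛt-D-P (- ƛ * ƛ⁻¹) n) ⟩
      ƛ * [1+ƛt]⁻¹ n + (- ƛ * ƛ⁻¹) * ƛ * [1+ƛt]⁻¹ n
        ≈⟨ +-congˡ (*-congʳ (trans (*-assoc _ _ _) (trans (*-congˡ ƛ⁻¹*ƛ) (*-identityʳ _)))) ⟩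
      ƛ * [1+ƛt]⁻¹ n + (- ƛ) * [1+ƛt]⁻¹ n
        ≈⟨ distribʳ _ _ _ ⟨
      (ƛ - ƛ) * [1+ƛt]⁻¹ n
        ≈⟨ trans (*-congʳ (-‿inverseʳ ƛ)) (zeroˡ _) ⟩
      0#
        ∎

  1+ƛt-cancelˡ : ∀ {F G} → 1+ƛt *ˢ F ≋ 1+ƛt *ˢ G → F ≋ G
  1+ƛt-cancelˡ = *ˢ-cancelˡ-inverse [1+ƛt]⁻¹ 1+ƛt
    λ n → trans (*ˢ-comm [1+ƛt]⁻¹ 1+ƛt n) (1+ƛt-inverseʳ n)

  -- The degenerate exponential and the argument U = 1 - 1/e.

  e e⁻¹ U : Series
  e   = P ƛ⁻¹
  e⁻¹ = P (- ƛ⁻¹)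
  U   = 1ˢ -ˢ e⁻¹

  1+ƛt-D-e : 1+ƛt *ˢ D e ≋ e
  1+ƛt-D-e n = trans (1+ƛt-D-P ƛ⁻¹ n) (trans (*-congʳ ƛ⁻¹*ƛ) (*-identityˡ _))

  1+ƛt-D-e⁻¹ : 1+ƛt *ˢ D e⁻¹ ≋ (- 1#) • e⁻¹
  1+ƛt-D-e⁻¹ n = trans (1+ƛt-D-P (- ƛ⁻¹) n)
    (*-congʳ (trans (sym (-‿distribˡ-* ƛ⁻¹ ƛ)) (-‿cong ƛ⁻¹*ƛ)))

  x-1*x : ∀ x → x + (- 1#) * x ≈ 0#
  x-1*x x = trans (+-congˡ (-1*x≈-x x)) (-‿inverseʳ x)

  -- The same method: after multiplication by `1+ƛt`, the two Leibniz terms of the derivative are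
  -- opposite.
  e-inverseʳ : e *ˢ e⁻¹ ≋ 1ˢ
  e-inverseʳ = D-0⇒1 (*ˢ-head {e} {e⁻¹} (P-0 ƛ⁻¹) (P-0 (- ƛ⁻¹))) (1+ƛt-cancelˡ (R.begin
    1+ƛt *ˢ D (e *ˢ e⁻¹)
      R.≈⟨ 𝕊.*-congˡ {1+ƛt} (D-*ˢ e e⁻¹) ⟩
    1+ƛt *ˢ (D e *ˢ e⁻¹ +ˢ e *ˢ D e⁻¹)
      R.≈⟨ solveˢ 5 (λ w a b c d → w :*ˢ (a :*ˢ b :+ˢ c :*ˢ d) :=ˢ (w :*ˢ a) :*ˢ b :+ˢ c :*ˢ (w :*ˢ d))
             (λ _ → refl) 1+ƛt (D e) e⁻¹ e (D e⁻¹) ⟩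
    1+ƛt *ˢ D e *ˢ e⁻¹ +ˢ e *ˢ (1+ƛt *ˢ D e⁻¹)
      R.≈⟨ 𝕊.+-cong (𝕊.*-congʳ {e⁻¹} 1+ƛt-D-e) (𝕊.*-congˡ {e} 1+ƛt-D-e⁻¹) ⟩
    e *ˢ e⁻¹ +ˢ e *ˢ ((- 1#) • e⁻¹)
      R.≈⟨ 𝕊.+-congˡ {e *ˢ e⁻¹} (*ˢ-• (- 1#) e e⁻¹) ⟩
    e *ˢ e⁻¹ +ˢ (- 1#) • (e *ˢ e⁻¹)
      R.≈⟨ (λ n → x-1*x ((e *ˢ e⁻¹) n)) ⟩
    0ˢ
      R.≈⟨ 𝕊.zeroʳ 1+ƛt ⟨
    1+ƛt *ˢ 0ˢ
      R.∎))

  U+e⁻¹ : U +ˢ e⁻¹ ≋ 1ˢ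
  U+e⁻¹ n = trans (+-assoc _ _ _) (trans (+-congˡ (-‿inverseˡ _)) (+-identityʳ _))

  -- Adding `1+ƛt *ˢ D e⁻¹` to either side gives zero: on the left because `U +ˢ e⁻¹` is constant,
  -- on the right by the differential equation of `e⁻¹`.
  1+ƛt-D-U : 1+ƛt *ˢ D U ≋ e⁻¹
  1+ƛt-D-U = 𝕊ₚ.+-cancelʳ (1+ƛt *ˢ D e⁻¹) (1+ƛt *ˢ D U) e⁻¹ (R.begin
    1+ƛt *ˢ D U +ˢ 1+ƛt *ˢ D e⁻¹   R.≈⟨ *ˢ-distribˡ 1+ƛt (D U) (D e⁻¹) ⟨
    1+ƛt *ˢ (D U +ˢ D e⁻¹)         R.≈⟨ 𝕊.*-congˡ {1+ƛt} (D-+ˢ U e⁻¹) ⟨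
    1+ƛt *ˢ D (U +ˢ e⁻¹)           R.≈⟨ 𝕊.*-congˡ {1+ƛt} (D-cong U+e⁻¹) ⟩
    1+ƛt *ˢ D 1ˢ                   R.≈⟨ 𝕊.*-congˡ {1+ƛt} D-1ˢ ⟩
    1+ƛt *ˢ 0ˢ                     R.≈⟨ 𝕊.zeroʳ 1+ƛt ⟩
    0ˢ                             R.≈⟨ (λ n → x-1*x (e⁻¹ n)) ⟨
    e⁻¹ +ˢ (- 1#) • e⁻¹            R.≈⟨ 𝕊.+-congˡ {e⁻¹} 1+ƛt-D-e⁻¹ ⟨
    e⁻¹ +ˢ 1+ƛt *ˢ D e⁻¹           R.∎)

  e*U : e *ˢ U ≋ E-1
  e*U = R.begin
    e *ˢ (1ˢ -ˢ e⁻¹)               R.≈⟨ 𝕊ₚ.x[y-z]≈xy-xz e 1ˢ e⁻¹ ⟩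
    (e *ˢ 1ˢ) -ˢ (e *ˢ e⁻¹)        R.≈⟨ (λ n → +-cong (𝕊.*-identityʳ e n) (-‿cong (e-inverseʳ n))) ⟩
    E-1                            R.∎

  -- `E-1` has no constant term and hence no inverse series; multiplying by `t/E-1` turns it into
  -- `t`, which cancels by a shift of indices.
  E-1-cancelˡ : ∀ {F G} → E-1 *ˢ F ≋ E-1 *ˢ G → F ≋ G
  E-1-cancelˡ {F} {G} EF≋EG = t*-cancelˡ (R.begin
    t *ˢ F                  R.≈⟨ 𝕊.*-congʳ {F} t/E-1-*ˢ ⟨
    t/E-1 *ˢ E-1 *ˢ F       R.≈⟨ *ˢ-assoc t/E-1 E-1 F ⟩
    t/E-1 *ˢ (E-1 *ˢ F)     R.≈⟨ 𝕊.*-congˡ {t/E-1} EF≋EG ⟩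
    t/E-1 *ˢ (E-1 *ˢ G)     R.≈⟨ *ˢ-assoc t/E-1 E-1 G ⟨
    t/E-1 *ˢ E-1 *ˢ G       R.≈⟨ 𝕊.*-congʳ {G} t/E-1-*ˢ ⟩
    t *ˢ G                  R.∎)

  U₀≈0 : U 0 ≈ 0#
  U₀≈0 = trans (+-congˡ (-‿cong (P-0 (- ƛ⁻¹)))) (-‿inverseʳ 1#)

  -- Polylogarithms evaluated at U.

  S : ℕ → Series
  S k = Li[ + k ]/u ∘ˢ U

  e⁻¹*S₀ : e⁻¹ *ˢ S 0 ≋ 1ˢ
  e⁻¹*S₀ = 𝕊ₚ.+-cancelˡ (U *ˢ S 0) (e⁻¹ *ˢ S 0) 1ˢ (R.begin
    U *ˢ S 0 +ˢ e⁻¹ *ˢ S 0   R.≈⟨ *ˢ-distribʳ (S 0) U e⁻¹ ⟨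
    (U +ˢ e⁻¹) *ˢ S 0        R.≈⟨ 𝕊.*-congʳ {S 0} U+e⁻¹ ⟩
    1ˢ *ˢ S 0                R.≈⟨ *ˢ-identityˡ (S 0) ⟩
    -- `S 0` is the geometric series of 1/(1 - U): all coefficients of `Li[ + 0 ]/u` are `1#`, so it
    -- is its own shift and Horner's rule returns `S 0`.
    S 0                      R.≈⟨ ∘ˢ-horner U U₀≈0 Li[ + 0 ]/u ⟩
    1# • 1ˢ +ˢ U *ˢ S 0      R.≈⟨ (λ n → +-congʳ (*-identityˡ (1ˢ n))) ⟩
    1ˢ +ˢ U *ˢ S 0           R.≈⟨ 𝕊.+-comm 1ˢ (U *ˢ S 0) ⟩
    U *ˢ S 0 +ˢ 1ˢ           R.∎)

  -- The polylogarithm itself. Its shift is `Li[ + k ]/u` by definition, so `∘ˢ-0` turns its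
  -- composition with `U` into `U *ˢ S k`.
  Li : ℕ → Series
  Li k zero    = 0#
  Li k (suc m) = Li[ + k ]/u m

  -- The factor `suc m` absorbs one of the `suc k` reciprocals: the classical lowering of the
  -- polylogarithm's index.
  D-Li : ∀ k → D (Li (suc k)) ≋ Li[ + k ]/u
  D-Li k m = trans (×-congʳ (suc m) (*-comm (1/ suc m) _)) (×-1/-cancel (suc m) _)

  -- The chain rule for the polylogarithm of index `suc k`; it is applied at 0 to find the logarithm
  -- and at 1 to find the dilogarithm.
  D-U*S : ∀ k → D (U *ˢ S (suc k)) ≋ S k *ˢ D U
  D-U*S k = R.begin
    D (U *ˢ S (suc k))                    R.≈⟨ D-cong (∘ˢ-0 U U₀≈0 {Li (suc k)} refl) ⟨
    D (Li (suc k) ∘ˢ U)                   R.≈⟨ D-∘ˢ U U₀≈0 (Li (suc k)) ⟩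
    (D (Li (suc k)) ∘ˢ U) *ˢ D U          R.≈⟨ 𝕊.*-congʳ {D U} (∘ˢ-congˡ U (D-Li k)) ⟩
    S k *ˢ D U                            R.∎

  -- The logarithm of 1 + λt.

  alternating : Series
  alternating n = (- 1#) ^ n

  D-log1+ : D log1+ ≋ alternating
  D-log1+ n = ×-1/-cancel (suc n) _

  ƛt₀≈0 : (ƛ • t) 0 ≈ 0#
  ƛt₀≈0 = zeroʳ ƛ

  -- Shifting `alternating` changes its sign, so Horner's rule reads G = 1 - VG with V = λt.
  1+ƛt-*-geometric : 1+ƛt *ˢ (alternating ∘ˢ (ƛ • t)) ≋ 1ˢ
  1+ƛt-*-geometric = R.begin
    (1ˢ +ˢ V) *ˢ G                        R.≈⟨ *ˢ-distribʳ G 1ˢ V ⟩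
    1ˢ *ˢ G +ˢ V *ˢ G                     R.≈⟨ 𝕊.+-congʳ (*ˢ-identityˡ G) ⟩
    G +ˢ V *ˢ G                           R.≈⟨ 𝕊.+-congʳ (∘ˢ-horner V ƛt₀≈0 alternating) ⟩
    1# • 1ˢ +ˢ V *ˢ G⁺ +ˢ V *ˢ G          R.≈⟨ 𝕊.+-assoc (1# • 1ˢ) (V *ˢ G⁺) (V *ˢ G) ⟩
    1# • 1ˢ +ˢ (V *ˢ G⁺ +ˢ V *ˢ G)        R.≈⟨ 𝕊.+-cong (λ n → *-identityˡ (1ˢ n)) (𝕊.sym (*ˢ-distribˡ V G⁺ G)) ⟩
    1ˢ +ˢ V *ˢ (G⁺ +ˢ G)                  R.≈⟨ 𝕊.+-congˡ {1ˢ} (𝕊.*-congˡ {V} G⁺+G) ⟩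
    1ˢ +ˢ V *ˢ 0ˢ                         R.≈⟨ 𝕊.+-congˡ {1ˢ} (𝕊.zeroʳ V) ⟩
    1ˢ +ˢ 0ˢ                              R.≈⟨ 𝕊.+-identityʳ 1ˢ ⟩
    1ˢ                                    R.∎
    where
    V = ƛ • t
    G = alternating ∘ˢ V
    G⁺ = (alternating ∘ suc) ∘ˢ V
    G⁺+G : G⁺ +ˢ G ≋ 0ˢ
    G⁺+G = R.begin
      G⁺ +ˢ G                                       R.≈⟨ ∘ˢ-+ˢ (alternating ∘ suc) alternating V ⟨
      ((alternating ∘ suc) +ˢ alternating) ∘ˢ V
        R.≈⟨ ∘ˢ-congˡ V (λ n → trans (+-comm _ _) (x-1*x (alternating n))) ⟩
      0ˢ ∘ˢ V                                       R.≈⟨ 0ˢ-∘ˢ V ⟩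
      0ˢ                                            R.∎

  D-log/ƛ : D log/ƛ ≋ alternating ∘ˢ (ƛ • t)
  D-log/ƛ n = begin
    D log/ƛ n                            ≈⟨ D-• ƛ⁻¹ log[1+ƛt] n ⟩
    ƛ⁻¹ * D log[1+ƛt] n                  ≈⟨ *-congˡ (D-∘ˢ V ƛt₀≈0 log1+ n) ⟩
    ƛ⁻¹ * ((D log1+ ∘ˢ V) *ˢ D V) n      ≈⟨ *-congˡ (*ˢ-cong (∘ˢ-congˡ V D-log1+) D-ƛt n) ⟩
    ƛ⁻¹ * (G *ˢ (ƛ • 1ˢ)) n              ≈⟨ *-congˡ (*ˢ-• ƛ G 1ˢ n) ⟩
    ƛ⁻¹ * (ƛ * (G *ˢ 1ˢ) n)              ≈⟨ *-assoc _ _ _ ⟨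
    ƛ⁻¹ * ƛ * (G *ˢ 1ˢ) n                ≈⟨ *-cong ƛ⁻¹*ƛ (𝕊.*-identityʳ G n) ⟩
    1# * G n                             ≈⟨ *-identityˡ _ ⟩
    G n                                  ∎
    where
    V = ƛ • t
    G = alternating ∘ˢ V

  -- Li₁(U) = -log (1 - U) = log (1 + ƛt) / ƛ.
  U*S₁ : U *ˢ S 1 ≋ log/ƛ
  U*S₁ = D-injective
    (trans (*ˢ-zero U U₀≈0 (S 1)) (sym log/ƛ₀≈0))
    (1+ƛt-cancelˡ (R.begin
      1+ƛt *ˢ D (U *ˢ S 1)      R.≈⟨ 𝕊.*-congˡ {1+ƛt} (D-U*S 0) ⟩
      1+ƛt *ˢ (S 0 *ˢ D U)      R.≈⟨ 𝕊*.x∙yz≈xz∙y 1+ƛt (S 0) (D U) ⟩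
      1+ƛt *ˢ D U *ˢ S 0        R.≈⟨ 𝕊.*-congʳ {S 0} 1+ƛt-D-U ⟩
      e⁻¹ *ˢ S 0                R.≈⟨ e⁻¹*S₀ ⟩
      1ˢ                        R.≈⟨ 1+ƛt-*-geometric ⟨
      1+ƛt *ˢ (alternating ∘ˢ (ƛ • t))  R.≈⟨ 𝕊.*-congˡ {1+ƛt} D-log/ƛ ⟨
      1+ƛt *ˢ D log/ƛ           R.∎))

  -- The dilogarithm as an antiderivative, and the resulting factorisation.

  B : Series
  B = log/ƛ/E-1 *ˢ [1+ƛt]⁻¹

  -- The antiderivative of B with a factor t removed.
  ∫B : Series
  ∫B n = B n * 1/ suc n

  D-t*∫B : D (t *ˢ ∫B) ≋ B
  D-t*∫B n = trans (×-congʳ (suc n) (t*-suc ∫B n)) (×-1/-cancel (suc n) (B n))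

  -- Identifies the derivative of Li₂(U). Multiplying by `1+ƛt` and `E-1` clears all denominators,
  -- and both sides reduce to `log/ƛ`.
  S₁*D-U : S 1 *ˢ D U ≋ B
  S₁*D-U = 1+ƛt-cancelˡ (E-1-cancelˡ (R.begin
    E-1 *ˢ (1+ƛt *ˢ (S 1 *ˢ D U))
      R.≈⟨ 𝕊.*-congˡ {E-1} (R.begin
         1+ƛt *ˢ (S 1 *ˢ D U)   R.≈⟨ 𝕊*.x∙yz≈y∙xz 1+ƛt (S 1) (D U) ⟩
         S 1 *ˢ (1+ƛt *ˢ D U)   R.≈⟨ 𝕊.*-congˡ {S 1} 1+ƛt-D-U ⟩
         S 1 *ˢ e⁻¹             R.∎) ⟩
    E-1 *ˢ (S 1 *ˢ e⁻¹)
      -- `E-1` is split so that `e` meets `e⁻¹` and `U` meets `S 1`, which forms the logarithm.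
      R.≈⟨ 𝕊.*-congʳ {S 1 *ˢ e⁻¹} e*U ⟨
    e *ˢ U *ˢ (S 1 *ˢ e⁻¹)
      R.≈⟨ solveˢ 4 (λ a b c d → a :*ˢ b :*ˢ (c :*ˢ d) :=ˢ a :*ˢ d :*ˢ (b :*ˢ c)) (λ _ → refl) e U (S 1) e⁻¹ ⟩
    e *ˢ e⁻¹ *ˢ (U *ˢ S 1)
      R.≈⟨ 𝕊.*-cong e-inverseʳ U*S₁ ⟩
    1ˢ *ˢ log/ƛ
      R.≈⟨ 𝕊.*-cong 1+ƛt-inverseʳ log/ƛ/E-1-*ˢ ⟨
    1+ƛt *ˢ [1+ƛt]⁻¹ *ˢ (log/ƛ/E-1 *ˢ E-1)
      R.≈⟨ solveˢ 4 (λ a b c d → a :*ˢ b :*ˢ (c :*ˢ d) :=ˢ d :*ˢ (a :*ˢ (c :*ˢ b))) (λ _ → refl)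
             1+ƛt [1+ƛt]⁻¹ log/ƛ/E-1 E-1 ⟩
    E-1 *ˢ (1+ƛt *ˢ B)
      R.∎))

  U*S₂ : U *ˢ S 2 ≋ t *ˢ ∫B
  U*S₂ = D-injective
    (trans (*ˢ-zero U U₀≈0 (S 2)) (sym (t*-zero ∫B)))
    (𝕊.trans (D-U*S 1) (𝕊.trans S₁*D-U (𝕊.sym D-t*∫B)))

  -- Multiplication by `E-1`, that is by `e *ˢ U`, supplies the factor `U` that `U*S₂` asks for; the
  -- `t` it yields is then rewritten through `t/E-1`.
  S₂-factorisation : S 2 ≋ (t/E-1 *ˢ e) *ˢ ∫B
  S₂-factorisation = E-1-cancelˡ (R.begin
    E-1 *ˢ S 2                    R.≈⟨ 𝕊.*-congʳ {S 2} e*U ⟨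
    e *ˢ U *ˢ S 2                 R.≈⟨ *ˢ-assoc e U (S 2) ⟩
    e *ˢ (U *ˢ S 2)               R.≈⟨ 𝕊.*-congˡ {e} U*S₂ ⟩
    e *ˢ (t *ˢ ∫B)                 R.≈⟨ 𝕊.*-congˡ {e} (𝕊.*-congʳ {∫B} t/E-1-*ˢ) ⟨
    e *ˢ (t/E-1 *ˢ E-1 *ˢ ∫B)
      R.≈⟨ solveˢ 4 (λ a b c d → a :*ˢ (b :*ˢ c :*ˢ d) :=ˢ c :*ˢ (b :*ˢ a :*ˢ d)) (λ _ → refl) e t/E-1 E-1 ∫B ⟩
    E-1 *ˢ (t/E-1 *ˢ e *ˢ ∫B)      R.∎)

  -- Comparison of coefficients.

  binomial-term : ∀ {n l} → l ≤ n → ∀ x y r →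
    (n !) × (x * (y * r)) ≈ (n C l) × (((l !) × x) * ((((n ∸ l) !) × y) * r))
  binomial-term {n} {l} l≤n x y r = sym (begin
    (n C l) × (((l !) × x) * ((((n ∸ l) !) × y) * r))
      ≈⟨ ×-congʳ (n C l) (trans (×-assoc-* (l !) x _)
           (×-congʳ (l !) (trans (*-congˡ (×-assoc-* ((n ∸ l) !) y r)) (×-comm-* ((n ∸ l) !) x (y * r))))) ⟩
    (n C l) × ((l !) × (((n ∸ l) !) × z))
      ≈⟨ ×-congʳ (n C l) (×-assocˡ z (l !) ((n ∸ l) !)) ⟩
    (n C l) × ((l ! ℕ.* (n ∸ l) !) × z)
      ≈⟨ ×-assocˡ z (n C l) (l ! ℕ.* (n ∸ l) !) ⟩
    ((n C l) ℕ.* (l ! ℕ.* (n ∸ l) !)) × z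
      ≈⟨ ×-congˡ {z} (nCk*k!*[n∸k]!≡n! l≤n) ⟩
    (n !) × z
      ∎)
    where z = x * (y * r)

  polyβ₂-formula : ∀ n → polyβ (+ 2) n ≈
    ∑[ l ≤ n ] ((n C toℕ l) × (β (toℕ l) 1# * (b (n ∸ toℕ l) (- ƛ) * 1/ suc (n ∸ toℕ l))))
  polyβ₂-formula n = begin
    (n !) × S 2 n
      ≈⟨ ×-congʳ (n !) (S₂-factorisation n) ⟩
    (n !) × ((t/E-1 *ˢ e) *ˢ ∫B) n
      -- The exponent of `e` is rewritten as `1# * ƛ⁻¹`, the form it takes in `β` at `1#`.
      ≈⟨ ×-congʳ (n !) (*ˢ-cong (𝕊.*-congˡ {t/E-1} (P-cong (sym (*-identityˡ ƛ⁻¹)))) (𝕊.refl {∫B}) n) ⟩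
    (n !) × (A *ˢ ∫B) n
      -- The multiple becomes a product in order to distribute over the sum, and is turned back in
      -- each term.
      ≈⟨ ×-as-* (n !) _ ⟩
    ((n !) × 1#) * (A *ˢ ∫B) n
      ≈⟨ *-distribˡ-sum {suc n} ((n !) × 1#) (λ l → A (toℕ l) * ∫B (n ∸ toℕ l)) ⟩
    ∑[ l ≤ n ] (((n !) × 1#) * (A (toℕ l) * ∫B (n ∸ toℕ l)))
      ≈⟨ sum-cong-≋ {suc n} (λ l → trans (sym (×-as-* (n !) _))
           (binomial-term (toℕ≤pred[n] l) (A (toℕ l)) (B (n ∸ toℕ l)) (1/ suc (n ∸ toℕ l)))) ⟩
    ∑[ l ≤ n ] ((n C toℕ l) × (β (toℕ l) 1# * (b (n ∸ toℕ l) (- ƛ) * 1/ suc (n ∸ toℕ l))))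
      ∎
    where
    A : Series
    A = t/E-1 *ˢ P (1# * ƛ⁻¹)

theorem3 : ∀ {c ℓ₁ ℓ₂} (K : HeytingField c ℓ₁ ℓ₂) (char0 : CharacteristicZero K) →
    (ƛ : HeytingField.Carrier K) (ƛ#0 : HeytingField._#_ K ƛ (HeytingField.0# K)) (n : ℕ) →
    let open Degenerate K char0 ƛ ƛ#0 in
    polyβ (+ 2) n ≈
    ∑[ l ≤ n ] ((n C toℕ l) × (β (toℕ l) 1# * (b (n ∸ toℕ l) (- ƛ) * 1/ suc (n ∸ toℕ l))))
theorem3 K char0 ƛ ƛ#0 = PolyBernoulli.polyβ₂-formula K char0 ƛ ƛ#0
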